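{- Let $q$ be a prime power, $k$ a positive integer, and $f(x)=a_0x+a_1x^q+a_2x^{q^2}\in\mathbb{F}_{q^k}[x]$. If $\mathrm{N}_{q^k/q}(a_0)+\mathrm{N}_{q^k/q}(a_2)=0$, then $f$ induces a permutation of $\mathbb{F}_{q^k}$ if and only if it induces a permutation of $\mathbb{F}_{q^{2k}}$.
   Context: $\mathrm{N}_{q^{k}/q}(x)=x^{q^{k-1}+\dots+q+1}$ denotes the norm of $x\in\mathbb{F}_{q^k}$ over $\mathbb{F}_q$. -}

module Defs where

open import Level using (Level; _⊔_)
open import Data.Nat using (ℕ; zero; suc; _≥_) renaming (_+_ to _+ℕ_; _*_ to _*ℕ_; _^_ to _^ℕ_)
open import Data.Nat.Primality using (Prime)
open import Data.Fin using (Fin)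
open import Data.Product using (Σ; ∃; _×_; _,_)
open import Relation.Nullary using (¬_)
open import Relation.Binary.PropositionalEquality using (_≡_)
open import Algebra.Bundles using (CommutativeRing)
open import Function.Definitions using (Bijective)

IsPrimePower : ℕ → Set
IsPrimePower q = Σ ℕ λ p → Σ ℕ λ e → Prime p × e ≥ 1 × q ≡ p ^ℕ e

normExp : ℕ → ℕ → ℕ
normExp q zero    = 0
normExp q (suc k) = q ^ℕ k +ℕ normExp q k

module _ {c ℓ : Level} (R : CommutativeRing c ℓ) where
  open CommutativeRing R

  pow : Carrier → ℕ → Carrier
  pow x zero    = 1#
  pow x (suc n) = x * pow x n

  record IsFiniteFieldOfOrder (n : ℕ) : Set (c ⊔ ℓ) where
    field
      0≉1      : ¬ (0# ≈ 1#)
      inverse  : ∀ x → ¬ (x ≈ 0#) → ∃ λ y → x * y ≈ 1#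
      enum     : Fin n → Carrier
      enum-bij : Bijective _≡_ _≈_ enum

  norm : ℕ → ℕ → Carrier → Carrier
  norm q k x = pow x (normExp q k)

  -- the subfield F_{q^k} = { x | x^(q^k) = x }
  InSubfield : ℕ → ℕ → Carrier → Set ℓ
  InSubfield q k x = pow x (q ^ℕ k) ≈ x

  linPoly : ℕ → Carrier → Carrier → Carrier → Carrier → Carrier
  linPoly q a0 a1 a2 x = a0 * x + a1 * pow x q + a2 * pow x (q ^ℕ 2)

  -- f induces a permutation of the subset S (assumed closed under f):
  -- injective on S and every element of S has a preimage in S
  PermutesSubset : (Carrier → Set ℓ) → (Carrier → Carrier) → Set (c ⊔ ℓ)
  PermutesSubset S f =
    (∀ x y → S x → S y → f x ≈ f y → x ≈ y) ×
    (∀ y → S y → ∃ λ x → S x × f x ≈ y)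

{-# OPTIONS --safe #-}
-- Write φ x = x^q, S = F_{q^k} and L = F_{q^{2k}}, and let f(x) = 0 with x ∈ L nonzero. Since x + φᵏ x is a
-- zero of f in S, permuting S forces φᵏ x = − x. Then y = φ(x)/x lies in S and has norm − 1, and
-- f = (a₂ φ − c) ∘ (φ − y) with a₀ = c y, so N(c) = − N(a₀) = N(a₂). The operator a₂ φ − c is therefore
-- killed on S by a q-polynomial T of q-degree k − 1, whose leading coefficient is N_{k-1}(a₂) (a partial norm).
-- As f is onto S, T vanishes on S, hence v ↦ T(v + φᵏ v) vanishes on L. This is a polynomial of degree
-- q^(2k-1) < |L|, so a₂ = 0, then a₀ = 0, then a₁ = 0, and f is not onto S. Conversely, φᵏ commutes with f,
-- so the preimage of an element of S under a bijective f is fixed by φᵏ.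
module Submission where

open import Defs
open import Level using (Level; _⊔_)
open import Algebra.Bundles using (CommutativeRing)
open import Data.Fin using (Fin; zero; suc; inject₁; fromℕ; punchIn; inject≤)
open import Data.Fin.Permutation using (Permutation; permutation; _⟨$⟩ʳ_)
open import Data.Fin.Properties
  using (any?; toℕ<n; toℕ-fromℕ; toℕ-inject₁; punchInᵢ≢i; injective⇒≤; inject≤-injective)
  renaming (_≟_ to _≟ᶠ_; suc-injective to sucᶠ-injective)
open import Data.Nat
  using (ℕ; zero; suc; pred; _≥_; _<_; _∸_; _!; NonZero; >-nonZero; nonTrivial⇒n>1; s≤s; z<s; s<s)
  renaming (_+_ to _+ℕ_; _*_ to _*ℕ_; _^_ to _^ℕ_; _≤_ to _≤ℕ_)
import Data.Nat.Properties as ℕ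
open import Data.Nat.Combinatorics using (_C_; nCk≡n!/k![n-k]!; k![n∸k]!∣n!; nCn≡1)
open import Data.Nat.Divisibility using (_∣_; divides; ∣⇒≤; m∣m*n)
open import Data.Nat.DivMod using (m/n*n≡m)
open import Data.Nat.Primality using (Prime; euclidsLemma; prime⇒nonTrivial)
open import Data.Product using (∃; _×_; _,_; proj₁; proj₂)
open import Data.Sum using (inj₁; inj₂)
open import Function using (_∘_)
open import Function.Definitions using (Injective; Surjective; Bijective)
open import Relation.Binary.PropositionalEquality as ≡ using (_≡_)
open import Relation.Nullary using (¬_; Dec; yes; no; contradiction)

-- Prime divisors of binomial coefficients, and the pigeonhole principle.

prime∣!⇒≤ : ∀ {p} → Prime p → ∀ m → p ∣ m ! → p ≤ℕ m
prime∣!⇒≤ pp zero    p∣1 = contradiction (∣⇒≤ p∣1) (ℕ.<⇒≱ (nonTrivial⇒n>1 _ ⦃ prime⇒nonTrivial pp ⦄))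
prime∣!⇒≤ pp (suc m) p∣ with euclidsLemma (suc m) (m !) pp p∣
... | inj₁ p∣1+m = ∣⇒≤ p∣1+m
... | inj₂ p∣m!  = ℕ.m≤n⇒m≤1+n (prime∣!⇒≤ pp m p∣m!)

-- `p` divides `p !`, the product of the coefficient with `k !` and `(p ∸ k) !`. Both factorials
-- belong to numbers below `p`, so neither can absorb the prime.
prime∣C : ∀ {p k} → Prime p → 0 < k → k < p → p ∣ p C k
prime∣C {suc p-1} {k} pp 0<k k<p
  with euclidsLemma (p C k) (k ! *ℕ (p ∸ k) !) pp (≡.subst (p ∣_) (≡.sym C*≡p!) (m∣m*n (p-1 !)))
  where
  p = suc p-1
  instance _ = k ℕ.!* (p ∸ k) !≢0
  C*≡p! : (p C k) *ℕ (k ! *ℕ (p ∸ k) !) ≡ p !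
  C*≡p! = ≡.trans (≡.cong (_*ℕ (k ! *ℕ (p ∸ k) !)) (nCk≡n!/k![n-k]! (ℕ.<⇒≤ k<p)))
                  (m/n*n≡m (k![n∸k]!∣n! (ℕ.<⇒≤ k<p)))
... | inj₁ p∣C = p∣C
... | inj₂ p∣k![p∸k]! with euclidsLemma (k !) _ pp p∣k![p∸k]!
...   | inj₁ p∣k!     = contradiction (prime∣!⇒≤ pp k p∣k!) (ℕ.<⇒≱ k<p)
...   | inj₂ p∣[p∸k]! = contradiction (prime∣!⇒≤ pp _ p∣[p∸k]!) (ℕ.<⇒≱ (ℕ.∸-monoʳ-< 0<k (ℕ.<⇒≤ k<p)))

-- A missed value `j`, put in front of `f`, would give an injection from `Fin (suc n)` to `Fin n`.
Fin-injective⇒surjective : ∀ {n} (f : Fin n → Fin n) → Injective _≡_ _≡_ f → ∀ j → ∃ λ i → f i ≡ j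
Fin-injective⇒surjective {n} f inj j with any? (λ i → f i ≟ᶠ j)
... | yes found = found
... | no  ¬found = contradiction (injective⇒≤ {f = g} g-injective) ℕ.1+n≰n
  where
  g : Fin (suc n) → Fin n
  g zero    = j
  g (suc i) = f i
  g-injective : Injective _≡_ _≡_ g
  g-injective {zero}  {zero}  _ = ≡.refl
  g-injective {zero}  {suc i} e = contradiction (i , ≡.sym e) ¬found
  g-injective {suc i} {zero}  e = contradiction (i , e) ¬found
  g-injective {suc i} {suc k} e = ≡.cong suc (inj e)

-- Powers in a commutative ring and the additivity of Frobenius.

module Powers {c ℓ} (R : CommutativeRing c ℓ) where
  open CommutativeRing R hiding (zero)
  open import Relation.Binary.Reasoning.Setoid setoid
  open import Algebra.Properties.CommutativeSemiring.Exp commutativeSemiring public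
    using (_^_; ^-congˡ; ^-homo-*; ^-assocʳ; ^-distrib-*)
  open import Algebra.Properties.Group +-group using (inverseˡ-unique)

  pow≡^ : ∀ x n → pow R x n ≡ x ^ n
  pow≡^ x zero    = ≡.refl
  pow≡^ x (suc n) = ≡.cong (x *_) (pow≡^ x n)

  pow-cong : ∀ n {x y} → x ≈ y → pow R x n ≈ pow R y n
  pow-cong n {x} {y} x≈y rewrite pow≡^ x n | pow≡^ y n = ^-congˡ n x≈y

  pow-+ : ∀ x m n → pow R x (m +ℕ n) ≈ pow R x m * pow R x n
  pow-+ x m n rewrite pow≡^ x (m +ℕ n) | pow≡^ x m | pow≡^ x n = ^-homo-* x m n

  pow-pow : ∀ x m n → pow R (pow R x m) n ≈ pow R x (m *ℕ n)
  pow-pow x m n rewrite pow≡^ x m | pow≡^ (x ^ m) n | pow≡^ x (m *ℕ n) = ^-assocʳ x m n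

  pow-* : ∀ n x y → pow R (x * y) n ≈ pow R x n * pow R y n
  pow-* n x y rewrite pow≡^ (x * y) n | pow≡^ x n | pow≡^ y n = ^-distrib-* x y n

  pow-0 : ∀ {n} → 0 < n → pow R 0# n ≈ 0#
  pow-0 z<s = zeroˡ _

  AdditivePow : ℕ → Set (c ⊔ ℓ)
  AdditivePow m = ∀ x y → pow R (x + y) m ≈ pow R x m + pow R y m

  AdditivePow-^ : ∀ {m} → AdditivePow m → ∀ j → AdditivePow (m ^ℕ j)
  AdditivePow-^ add zero x y = distribʳ _ _ _
  AdditivePow-^ {m} add (suc j) x y = begin
    pow R (x + y) (m *ℕ m ^ℕ j)                            ≈⟨ pow-pow _ m _ ⟨
    pow R (pow R (x + y) m) (m ^ℕ j)                       ≈⟨ pow-cong (m ^ℕ j) (add x y) ⟩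
    pow R (pow R x m + pow R y m) (m ^ℕ j)                 ≈⟨ AdditivePow-^ add j _ _ ⟩
    pow R (pow R x m) (m ^ℕ j) + pow R (pow R y m) (m ^ℕ j) ≈⟨ +-cong (pow-pow _ m _) (pow-pow _ m _) ⟩
    pow R x (m *ℕ m ^ℕ j) + pow R y (m *ℕ m ^ℕ j)          ∎

  pow-neg : ∀ {m} → AdditivePow m → 0 < m → ∀ x → pow R (- x) m ≈ - pow R x m
  pow-neg {m} add 0<m x =
    inverseˡ-unique _ _ (trans (sym (add (- x) x)) (trans (pow-cong m (-‿inverseˡ x)) (pow-0 0<m)))

  open import Algebra.Properties.Semiring.Mult semiring
    using (×-assoc-*; ×-assocˡ; ×-congʳ) renaming (_×_ to _·_)
  open import Algebra.Properties.Monoid.Sum +-monoid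
    using (sum; sum-init-last; sum-cong-≋; sum-replicate-zero)
  open import Algebra.Properties.CommutativeSemiring.Binomial commutativeSemiring
    using (theorem; binomialTerm)

  -- In the binomial expansion every inner coefficient is a multiple of `p` and is killed by the
  -- characteristic; only the two end terms survive.
  frobenius-additive : ∀ {p} → Prime p → p · 1# ≈ 0# → AdditivePow p
  frobenius-additive {suc r} pp p·1≈0 x y
    rewrite pow≡^ (x + y) (suc r) | pow≡^ x (suc r) | pow≡^ y (suc r) = begin
    (x + y) ^ p                       ≈⟨ theorem p x y ⟩
    -- The term with index i carries `x` to the power i, so the first one is `y ^ p` and the last
    -- one `x ^ p`.
    term zero + sum (term ∘ suc)      ≈⟨ +-cong (trans (+-identityʳ _) (*-identityˡ _)) (sum-init-last (term ∘ suc)) ⟩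
    y ^ p + (sum middle + term (suc (fromℕ r)))
      ≈⟨ +-congˡ (+-cong (trans (sum-cong-≋ middle≈0) (sum-replicate-zero r)) last≈) ⟩
    y ^ p + (0# + x ^ p)              ≈⟨ +-congˡ (+-identityˡ _) ⟩
    y ^ p + x ^ p                     ≈⟨ +-comm _ _ ⟩
    x ^ p + y ^ p                     ∎
    where
    p = suc r
    term = binomialTerm x y p
    middle : Fin r → Carrier
    middle i = term (suc (inject₁ i))
    p∣·≈0 : ∀ {m} → p ∣ m → ∀ z → m · z ≈ 0#
    p∣·≈0 (divides d ≡.refl) z = begin
      (d *ℕ p) · z        ≡⟨ ≡.cong (_· z) (ℕ.*-comm d p) ⟩
      (p *ℕ d) · z        ≈⟨ ×-assocˡ z p d ⟨
      p · (d · z)         ≈⟨ ×-congʳ p (*-identityˡ _) ⟨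
      p · (1# * (d · z))  ≈⟨ ×-assoc-* p 1# _ ⟨
      (p · 1#) * (d · z)  ≈⟨ *-congʳ p·1≈0 ⟩
      0# * (d · z)        ≈⟨ zeroˡ _ ⟩
      0#                  ∎
    middle≈0 : ∀ i → middle i ≈ 0#
    middle≈0 i = p∣·≈0 (prime∣C pp z<s (s<s (≡.subst (_< r) (≡.sym (toℕ-inject₁ i)) (toℕ<n i)))) _
    last≈ : term (suc (fromℕ r)) ≈ x ^ p
    last≈ rewrite toℕ-fromℕ r | nCn≡1 p | ℕ.n∸n≡0 r = trans (+-identityʳ _) (*-identityʳ _)

-- Polynomial functions with a degree bound.

module PolynomialFunctions {c ℓ} (R : CommutativeRing c ℓ) where
  open CommutativeRing R hiding (zero)
  open import Relation.Binary.Reasoning.Setoid setoid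
  open import Algebra.Solver.Ring.NaturalCoefficients.Default commutativeSemiring

  -- F is given by a polynomial of degree at most n whose coefficient at xⁿ is a (which may vanish).
  Poly : ℕ → Carrier → (Carrier → Carrier) → Set (c ⊔ ℓ)
  Poly zero    a F = ∀ x → F x ≈ a
  Poly (suc n) a F = ∃ λ G → ∃ λ b → Poly n a G × (∀ x → F x ≈ x * G x + b)

  poly-cong : ∀ n {a b F G} → a ≈ b → (∀ x → F x ≈ G x) → Poly n a F → Poly n b G
  poly-cong zero    a≈b F≈G F≈a x = trans (sym (F≈G x)) (trans (F≈a x) a≈b)
  poly-cong (suc n) a≈b F≈G (H , r , pH , F≈) =
    H , r , poly-cong n a≈b (λ _ → refl) pH , λ x → trans (sym (F≈G x)) (F≈ x)

  poly-+ : ∀ n {a b F G} → Poly n a F → Poly n b G → Poly n (a + b) (λ x → F x + G x)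
  poly-+ zero    F≈a G≈b x = +-cong (F≈a x) (G≈b x)
  poly-+ (suc n) (H , r , pH , F≈) (K , s , pK , G≈) =
    (λ x → H x + K x) , r + s , poly-+ n pH pK , λ x → trans (+-cong (F≈ x) (G≈ x))
      (solve 5 (λ x h k r s → (x :* h :+ r) :+ (x :* k :+ s) := x :* (h :+ k) :+ (r :+ s)) refl x (H x) (K x) r s)

  poly-scale : ∀ n d {a F} → Poly n a F → Poly n (d * a) (λ x → d * F x)
  poly-scale zero    d F≈a x = *-congˡ (F≈a x)
  poly-scale (suc n) d (H , r , pH , F≈) =
    (λ x → d * H x) , d * r , poly-scale n d pH , λ x → trans (*-congˡ (F≈ x))
      (solve 4 (λ d x h r → d :* (x :* h :+ r) := x :* (d :* h) :+ d :* r) refl d x (H x) r)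

  poly-zero : ∀ n → Poly n 0# (λ _ → 0#)
  poly-zero zero    x = refl
  poly-zero (suc n) = (λ _ → 0#) , 0# , poly-zero n , λ x → sym (trans (+-identityʳ _) (zeroʳ x))

  poly-raise : ∀ n {a F} → Poly n a F → Poly (suc n) 0# F
  poly-raise zero    {a} F≈a = (λ _ → 0#) , a , (λ _ → refl) ,
    λ x → trans (F≈a x) (sym (trans (+-congʳ (zeroʳ x)) (+-identityˡ a)))
  poly-raise (suc n) (H , r , pH , F≈) = H , r , poly-raise n pH , F≈

  poly-raise-< : ∀ {m n a F} → m < n → Poly m a F → Poly n 0# F
  poly-raise-< {m} {suc n} (s≤s m≤n) pF with ℕ.m≤n⇒m<n∨m≡n m≤n
  ... | inj₁ m<n    = poly-raise n (poly-raise-< m<n pF)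
  ... | inj₂ ≡.refl = poly-raise n pF

  poly-pow : ∀ n → Poly n 1# (λ x → pow R x n)
  poly-pow zero    x = refl
  poly-pow (suc n) = (λ x → pow R x n) , 0# , poly-pow n , λ x → sym (+-identityʳ _)

  -- The division F x − F r = (x − r) Q x, written without subtraction.
  poly-divide : ∀ n {a F} → Poly (suc n) a F → ∀ r →
                ∃ λ Q → Poly n a Q × (∀ x → F x + r * Q x ≈ x * Q x + F r)
  poly-divide zero {a} {F} (G , b , G≈a , F≈) r = G , G≈a , λ x → begin
    F x + r * G x                ≈⟨ +-cong (F≈ x) (*-congˡ (trans (G≈a x) (sym (G≈a r)))) ⟩
    (x * G x + b) + r * G r      ≈⟨ solve 3 (λ u b v → (u :+ b) :+ v := u :+ (v :+ b)) refl _ b _ ⟩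
    x * G x + (r * G r + b)      ≈⟨ +-congˡ (F≈ r) ⟨
    x * G x + F r                ∎
  poly-divide (suc n) {a} {F} (G , b , pG , F≈) r with poly-divide n pG r
  ... | H , pH , G≈ = Q , pQ , λ x → begin
    F x + r * Q x                             ≈⟨ +-congʳ (F≈ x) ⟩
    (x * G x + b) + r * (G x + r * H x)       ≈⟨ +-congˡ (*-congˡ (G≈ x)) ⟩
    (x * G x + b) + r * (x * H x + G r)       ≈⟨ solve 6 (λ x g b r h k →
      (x :* g :+ b) :+ r :* (x :* h :+ k) := x :* (g :+ r :* h) :+ (r :* k :+ b)) refl x (G x) b r (H x) (G r) ⟩
    x * (G x + r * H x) + (r * G r + b)       ≈⟨ +-congˡ (F≈ r) ⟨
    x * Q x + F r                             ∎
    where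
    -- Since xG(x) - rG(r) = (x - r)G(x) + r(G(x) - G(r)), the quotient is G + rH, where H is the
    -- quotient for G. The degree bound of H is lower, so the top coefficient stays `a`.
    Q : Carrier → Carrier
    Q x = G x + r * H x
    pQ : Poly (suc n) a Q
    pQ = poly-cong (suc n) (trans (+-congˡ (zeroʳ r)) (+-identityʳ a)) (λ _ → refl)
           (poly-+ (suc n) pG (poly-scale (suc n) r (poly-raise n pH)))

-- Finite fields: order, characteristic, number of roots.

module FiniteField {c ℓ} (L : CommutativeRing c ℓ) {n} (isFF : IsFiniteFieldOfOrder L n) where
  open CommutativeRing L hiding (zero)
  open IsFiniteFieldOfOrder isFF
  open import Relation.Binary.Reasoning.Setoid setoid
  open import Algebra.Properties.Group +-group using () renaming (∙-cancelʳ to +-cancelʳ)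
  open import Algebra.Properties.Semiring.Mult semiring using (×1-homo-*) renaming (_×_ to _·_)
  import Algebra.Properties.CommutativeMonoid.Sum as CommutativeMonoidSum
  open CommutativeMonoidSum +-commutativeMonoid using (sum; sum-permute; sum-replicate; sum-cong-≋; ∑-distrib-+)
  private module ∏ = CommutativeMonoidSum *-commutativeMonoid
  open Powers L
  open PolynomialFunctions L

  index : Carrier → Fin n
  index x = proj₁ (proj₂ enum-bij x)

  enum-index : ∀ x → enum (index x) ≈ x
  enum-index x = proj₂ (proj₂ enum-bij x) ≡.refl

  enum-injective : ∀ {i j} → enum i ≈ enum j → i ≡ j
  enum-injective = proj₁ enum-bij

  index-cong : ∀ {x y} → x ≈ y → index x ≡ index y
  index-cong x≈y = enum-injective (trans (enum-index _) (trans x≈y (sym (enum-index _))))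

  _≟_ : ∀ x y → Dec (x ≈ y)
  x ≟ y with index x ≟ᶠ index y
  ... | yes i≡j = yes (trans (sym (enum-index x)) (trans (reflexive (≡.cong enum i≡j)) (enum-index y)))
  ... | no  i≢j = no (i≢j ∘ index-cong)

  injective⇒surjective : ∀ {f : Carrier → Carrier} → (∀ {x y} → x ≈ y → f x ≈ f y) →
                         Injective _≈_ _≈_ f → Surjective _≈_ _≈_ f
  injective⇒surjective {f} f-cong f-inj y
    with i , e ← Fin-injective⇒surjective (index ∘ f ∘ enum)
           (λ e → enum-injective (f-inj (trans (sym (enum-index _)) (trans (reflexive (≡.cong enum e)) (enum-index _)))))
           (index y)
    = enum i , λ z≈ → trans (f-cong z≈)
        (trans (sym (enum-index _)) (trans (reflexive (≡.cong enum e)) (enum-index y)))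

  *-cancelʳ-≉0 : ∀ {x y z} → ¬ z ≈ 0# → x * z ≈ y * z → x ≈ y
  *-cancelʳ-≉0 {x} {y} {z} z≉0 xz≈yz with w , zw≈1 ← inverse z z≉0 = begin
    x            ≈⟨ *-identityʳ x ⟨
    x * 1#       ≈⟨ *-congˡ zw≈1 ⟨
    x * (z * w)  ≈⟨ *-assoc x z w ⟨
    (x * z) * w  ≈⟨ *-congʳ xz≈yz ⟩
    (y * z) * w  ≈⟨ *-assoc y z w ⟩
    y * (z * w)  ≈⟨ *-congˡ zw≈1 ⟩
    y * 1#       ≈⟨ *-identityʳ y ⟩
    y            ∎

  *-≈0 : ∀ {x y} → x * y ≈ 0# → ¬ y ≈ 0# → x ≈ 0#
  *-≈0 xy≈0 y≉0 = *-cancelʳ-≉0 y≉0 (trans xy≈0 (sym (zeroˡ _)))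

  pow≈0 : ∀ {x} m → pow L x m ≈ 0# → x ≈ 0#
  pow≈0 zero    1≈0 = contradiction (sym 1≈0) 0≉1
  pow≈0 {x} (suc m) x^≈0 with x ≟ 0#
  ... | yes x≈0 = x≈0
  ... | no  x≉0 = pow≈0 m (*-≈0 (trans (*-comm _ x) x^≈0) x≉0)

  inverses⇒permutation : (f g : Carrier → Carrier) →
    (∀ {x y} → x ≈ y → f x ≈ f y) → (∀ {x y} → x ≈ y → g x ≈ g y) →
    (∀ x → f (g x) ≈ x) → (∀ x → g (f x) ≈ x) → Permutation n n
  inverses⇒permutation f g f-cong g-cong fg gf = permutation (index ∘ f ∘ enum) (index ∘ g ∘ enum)
    (λ i → enum-injective (trans (enum-index _) (trans (f-cong (enum-index _)) (fg _))))
    (λ i → enum-injective (trans (enum-index _) (trans (g-cong (enum-index _)) (gf _))))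

  -- Translation by 1 permutes the field, so adding `n · 1#` to the sum of all elements does not
  -- change it.
  order·1≈0 : n · 1# ≈ 0#
  order·1≈0 = +-cancelʳ (sum enum) _ _ (begin
    n · 1# + sum enum            ≈⟨ +-congʳ (sum-replicate n) ⟨
    sum (λ (_ : Fin n) → 1#) + sum enum ≈⟨ ∑-distrib-+ (λ _ → 1#) enum ⟨
    sum (λ i → 1# + enum i)      ≈⟨ sum-cong-≋ (λ i → enum-index (1# + enum i)) ⟨
    sum (λ i → enum (π ⟨$⟩ʳ i))  ≈⟨ sum-permute enum π ⟨
    sum enum                     ≈⟨ +-identityˡ _ ⟨
    0# + sum enum                ∎)
    where
    cancel : ∀ u v {x} → u + v ≈ 0# → u + (v + x) ≈ x
    cancel u v u+v≈0 = trans (sym (+-assoc _ _ _)) (trans (+-congʳ u+v≈0) (+-identityˡ _))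
    π = inverses⇒permutation (1# +_) (- 1# +_) +-congˡ +-congˡ
          (λ _ → cancel _ _ (-‿inverseʳ 1#)) (λ _ → cancel _ _ (-‿inverseˡ 1#))

  -- Serves `pow-order`, where the exceptional factor sits at zero. The extra `x` makes up for that
  -- factor, so the exponent is `m` and no predecessor appears.
  ∏-all-but-one : ∀ {m} (t : Fin m → Carrier) i {x} → t i ≈ 1# → (∀ j → ¬ j ≡ i → t j ≈ x) →
                  x * ∏.sum t ≈ pow L x m
  ∏-all-but-one {suc m} t i {x} ti≈1 t≈x = *-congˡ (begin
    ∏.sum t                          ≈⟨ ∏.sum-remove t ⟩
    t i * ∏.sum (t ∘ punchIn i)      ≈⟨ *-cong ti≈1 (∏.sum-cong-≋ (λ j → t≈x _ (punchInᵢ≢i i j))) ⟩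
    1# * ∏.sum (λ (_ : Fin m) → x)   ≈⟨ *-identityˡ _ ⟩
    ∏.sum (λ (_ : Fin m) → x)        ≈⟨ ∏.sum-replicate m ⟩
    x ^ m                            ≡⟨ pow≡^ x m ⟨
    pow L x m                        ∎)

  ∏≉0 : ∀ {m} (t : Fin m → Carrier) → (∀ i → ¬ t i ≈ 0#) → ¬ ∏.sum t ≈ 0#
  ∏≉0 {zero}  t t≉0 1≈0 = 0≉1 (sym 1≈0)
  ∏≉0 {suc m} t t≉0 ∏≈0 = t≉0 zero (*-≈0 ∏≈0 (∏≉0 (t ∘ suc) (t≉0 ∘ suc)))

  -- Replacing 0 by 1 lets products over all of L run over its nonzero elements.
  unit : Carrier → Carrier
  unit y with y ≟ 0#
  ... | yes _ = 1#
  ... | no  _ = y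

  unit≉0 : ∀ y → ¬ unit y ≈ 0#
  unit≉0 y with y ≟ 0#
  ... | yes _   = λ 1≈0 → 0≉1 (sym 1≈0)
  ... | no  y≉0 = y≉0

  unit-cong : ∀ {y z} → y ≈ z → unit y ≈ unit z
  unit-cong {y} {z} y≈z with y ≟ 0# | z ≟ 0#
  ... | yes _   | yes _   = refl
  ... | yes y≈0 | no  z≉0 = contradiction (trans (sym y≈z) y≈0) z≉0
  ... | no  y≉0 | yes z≈0 = contradiction (trans y≈z z≈0) y≉0
  ... | no  _   | no  _   = y≈z

  -- The ratio of `unit (x * y)` to `unit y` for nonzero `x`; at `y ≈ 0#` both units are 1.
  factor : Carrier → Carrier → Carrier
  factor x y with y ≟ 0#
  ... | yes _ = 1#
  ... | no  _ = x

  factor-zero : ∀ x {y} → y ≈ 0# → factor x y ≈ 1#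
  factor-zero x {y} y≈0 with y ≟ 0#
  ... | yes _   = refl
  ... | no  y≉0 = contradiction y≈0 y≉0

  factor-nonzero : ∀ x {y} → ¬ y ≈ 0# → factor x y ≈ x
  factor-nonzero x {y} y≉0 with y ≟ 0#
  ... | yes y≈0 = contradiction y≈0 y≉0
  ... | no  _   = refl

  unit-* : ∀ {x} → ¬ x ≈ 0# → ∀ y → unit (x * y) ≈ factor x y * unit y
  unit-* {x} x≉0 y with (x * y) ≟ 0# | y ≟ 0#
  ... | yes _    | yes _   = sym (*-identityˡ 1#)
  ... | yes xy≈0 | no y≉0  = contradiction (*-≈0 xy≈0 y≉0) x≉0
  ... | no xy≉0  | yes y≈0 = contradiction (trans (*-congˡ y≈0) (zeroʳ x)) xy≉0
  ... | no  _    | no  _   = refl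

  -- Multiplication by a nonzero `x` permutes the nonzero elements; comparing their product before
  -- and after leaves x^(n-1) = 1.
  pow-order : ∀ x → pow L x n ≈ x
  pow-order x with x ≟ 0#
  ... | yes x≈0 = trans (pow-cong n x≈0) (trans (pow-0 (0<∣Fin∣ (index 0#))) (sym x≈0))
    where
    0<∣Fin∣ : ∀ {m} → Fin m → 0 < m
    0<∣Fin∣ zero    = z<s
    0<∣Fin∣ (suc _) = z<s
  ... | no  x≉0 with w , xw≈1 ← inverse x x≉0 = begin
    pow L x n       ≈⟨ ∏-all-but-one (factor x ∘ enum) (index 0#) (factor-zero x (enum-index 0#))
                         (λ j j≢ → factor-nonzero x (λ e → j≢ (enum-injective (trans e (sym (enum-index 0#)))))) ⟨
    x * ∏.sum (factor x ∘ enum) ≈⟨ *-congˡ ∏factor≈1 ⟩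
    x * 1#          ≈⟨ *-identityʳ x ⟩
    x               ∎
    where
    cancel : ∀ u v {y} → u * v ≈ 1# → u * (v * y) ≈ y
    cancel u v uv≈1 = trans (sym (*-assoc _ _ _)) (trans (*-congʳ uv≈1) (*-identityˡ _))
    π = inverses⇒permutation (x *_) (w *_) *-congˡ *-congˡ
          (λ _ → cancel _ _ xw≈1) (λ _ → cancel _ _ (trans (*-comm w x) xw≈1))
    ∏factor≈1 : ∏.sum (factor x ∘ enum) ≈ 1#
    ∏factor≈1 = *-cancelʳ-≉0 (∏≉0 (unit ∘ enum) (unit≉0 ∘ enum)) (begin
      ∏.sum (factor x ∘ enum) * ∏.sum (unit ∘ enum)   ≈⟨ ∏.∑-distrib-+ (factor x ∘ enum) (unit ∘ enum) ⟨
      ∏.sum (λ i → factor x (enum i) * unit (enum i)) ≈⟨ ∏.sum-cong-≋ (λ i → trans (unit-cong (enum-index _)) (unit-* x≉0 (enum i))) ⟨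
      ∏.sum (λ i → unit (enum (π ⟨$⟩ʳ i)))            ≈⟨ ∏.sum-permute (unit ∘ enum) π ⟨
      ∏.sum (unit ∘ enum)                             ≈⟨ *-identityˡ _ ⟨
      1# * ∏.sum (unit ∘ enum)                        ∎)

  -- The order p^m annihilates 1, and p^m times 1 is the m-th power of p times 1; a field has no
  -- nonzero nilpotents.
  characteristic : ∀ {p} m → n ≡ p ^ℕ m → p · 1# ≈ 0#
  characteristic {p} m ≡.refl = pow≈0 m (trans (sym (^·1 m)) order·1≈0)
    where
    ^·1 : ∀ m → (p ^ℕ m) · 1# ≈ pow L (p · 1#) m
    ^·1 zero    = +-identityʳ 1#
    ^·1 (suc m) = trans (×1-homo-* p (p ^ℕ m)) (*-congˡ (^·1 m))

  -- Dividing by the linear factor of the first root keeps the top coefficient and lowers the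
  -- degree, and the other roots pass to the quotient. After m divisions a constant function with
  -- value `a` still has a zero.
  poly-roots : ∀ m {a F} → Poly m a F → (r : Fin (suc m) → Carrier) → (∀ {i j} → r i ≈ r j → i ≡ j) →
               (∀ i → F (r i) ≈ 0#) → a ≈ 0#
  poly-roots zero    F≈a r r-inj F≈0 = trans (sym (F≈a (r zero))) (F≈0 zero)
  poly-roots (suc m) {F = F} pF r r-inj F≈0 with Q , pQ , F≈ ← poly-divide m pF (r zero) =
    poly-roots m pQ (r ∘ suc) (sucᶠ-injective ∘ r-inj) Q≈0
    where
    Q≈0 : ∀ i → Q (r (suc i)) ≈ 0#
    Q≈0 i with Q (r (suc i)) ≟ 0#
    ... | yes q≈0 = q≈0
    -- A nonzero value of the quotient could be cancelled, which would identify two distinct roots.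
    ... | no  q≉0 with () ← r-inj {zero} {suc i} (*-cancelʳ-≉0 q≉0 (begin
      r zero * Q (r (suc i))                    ≈⟨ +-identityˡ _ ⟨
      0# + r zero * Q (r (suc i))               ≈⟨ +-congʳ (F≈0 (suc i)) ⟨
      F (r (suc i)) + r zero * Q (r (suc i))    ≈⟨ F≈ (r (suc i)) ⟩
      r (suc i) * Q (r (suc i)) + F (r zero)    ≈⟨ +-congˡ (F≈0 zero) ⟩
      r (suc i) * Q (r (suc i)) + 0#            ≈⟨ +-identityʳ _ ⟩
      r (suc i) * Q (r (suc i))                 ∎))

  vanishing-poly : ∀ {m a F} → m < n → Poly m a F → (∀ x → F x ≈ 0#) → a ≈ 0#
  vanishing-poly m<n pF F≈0 = poly-roots _ pF (λ i → enum (inject≤ i m<n))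
    (λ e → inject≤-injective m<n m<n _ _ (enum-injective e)) (λ _ → F≈0 _)

-- Iterates of the q-Frobenius, norms and q-polynomials.

module Linearized {c ℓ} (L : CommutativeRing c ℓ) (q : ℕ) (0<q : 0 < q)
                  (frob-+ : Powers.AdditivePow L q) where
  open CommutativeRing L hiding (zero)
  open import Relation.Binary.Reasoning.Setoid setoid
  open import Algebra.Properties.Group +-group using () renaming (∙-cancelʳ to +-cancelʳ)
  open import Algebra.Solver.Ring.NaturalCoefficients.Default commutativeSemiring
  open Powers L
  open PolynomialFunctions L

  instance
    q≢0 : NonZero q
    q≢0 = >-nonZero 0<q

  φ : ℕ → Carrier → Carrier
  φ j x = pow L x (q ^ℕ j)

  φ-cong : ∀ j {x y} → x ≈ y → φ j x ≈ φ j y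
  φ-cong j = pow-cong (q ^ℕ j)

  φ-+ : ∀ j x y → φ j (x + y) ≈ φ j x + φ j y
  φ-+ = AdditivePow-^ frob-+

  φ-* : ∀ j x y → φ j (x * y) ≈ φ j x * φ j y
  φ-* j = pow-* (q ^ℕ j)

  φ-0 : ∀ j → φ j 0# ≈ 0#
  φ-0 j = pow-0 (ℕ.m^n>0 q j)

  φ-neg : ∀ j x → φ j (- x) ≈ - φ j x
  φ-neg j = pow-neg (φ-+ j) (ℕ.m^n>0 q j)

  φ-suc : ∀ j x → φ j (pow L x q) ≈ φ (suc j) x
  φ-suc j x = pow-pow x q (q ^ℕ j)

  φ-pow : ∀ j x m → φ j (pow L x m) ≈ pow L (φ j x) m
  φ-pow j x m = begin
    pow L (pow L x m) (q ^ℕ j)   ≈⟨ pow-pow x m _ ⟩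
    pow L x (m *ℕ q ^ℕ j)        ≡⟨ ≡.cong (pow L x) (ℕ.*-comm m _) ⟩
    pow L x (q ^ℕ j *ℕ m)        ≈⟨ pow-pow x (q ^ℕ j) m ⟨
    pow L (pow L x (q ^ℕ j)) m   ∎

  φ-φ : ∀ i j x → φ j (φ i x) ≈ φ (i +ℕ j) x
  φ-φ i j x = trans (pow-pow x (q ^ℕ i) (q ^ℕ j)) (reflexive (≡.cong (pow L x) (≡.sym (ℕ.^-distribˡ-+-* q i j))))

  pow-q² : ∀ x → pow L (pow L x q) q ≈ pow L x (q ^ℕ 2)
  pow-q² x = trans (pow-pow x q q) (reflexive (≡.cong (λ m → pow L x (q *ℕ m)) (≡.sym (ℕ.*-identityʳ q))))

  module Subfield (k : ℕ) where
    S : Carrier → Set ℓ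
    S = InSubfield L q k

    S-+ : ∀ {x y} → S x → S y → S (x + y)
    S-+ Sx Sy = trans (φ-+ k _ _) (+-cong Sx Sy)

    S-* : ∀ {x y} → S x → S y → S (x * y)
    S-* Sx Sy = trans (φ-* k _ _) (*-cong Sx Sy)

    S-neg : ∀ {x} → S x → S (- x)
    S-neg Sx = trans (φ-neg k _) (-‿cong Sx)

    S-0 : S 0#
    S-0 = φ-0 k

    S-pow : ∀ {x} m → S x → S (pow L x m)
    S-pow m Sx = trans (φ-pow k _ m) (pow-cong m Sx)

    S-1 : S 1#
    S-1 = S-pow {0#} 0 S-0

  norm-suc : ∀ j x → norm L q (suc j) x ≈ φ j x * norm L q j x
  norm-suc j x = pow-+ x (q ^ℕ j) (normExp q j)

  norm-0 : ∀ j → 1 ≤ℕ j → norm L q j 0# ≈ 0#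
  norm-0 (suc j) _ = pow-0 (ℕ.<-≤-trans (ℕ.m^n>0 q j) (ℕ.m≤m+n _ _))

  -- `x` is an eigenvector of Frobenius with eigenvalue `y`. Each further iteration contributes one
  -- conjugate of `y`, and these multiply to the exponent 1 + q + ... + q^(j-1).
  norm-eigenvalue : ∀ {x y} → y * x ≈ pow L x q → ∀ j → φ j x ≈ norm L q j y * x
  norm-eigenvalue {x} {y} yx≈x^q zero    = trans (*-identityʳ x) (sym (*-identityˡ x))
  norm-eigenvalue {x} {y} yx≈x^q (suc j) = begin
    φ (suc j) x                   ≈⟨ φ-suc j x ⟨
    φ j (pow L x q)               ≈⟨ φ-cong j yx≈x^q ⟨
    φ j (y * x)                   ≈⟨ φ-* j y x ⟩
    φ j y * φ j x                 ≈⟨ *-congˡ (norm-eigenvalue yx≈x^q j) ⟩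
    φ j y * (norm L q j y * x)    ≈⟨ *-assoc _ _ _ ⟨
    φ j y * norm L q j y * x      ≈⟨ *-congʳ (norm-suc j y) ⟨
    norm L q (suc j) y * x        ∎

  module _ (a₀ a₁ a₂ : Carrier) where
    private
      f = linPoly L q a₀ a₁ a₂

    linPoly-cong : ∀ {x y} → x ≈ y → f x ≈ f y
    linPoly-cong x≈y = +-cong (+-cong (*-congˡ x≈y) (*-congˡ (pow-cong q x≈y))) (*-congˡ (pow-cong (q ^ℕ 2) x≈y))

    linPoly-+ : ∀ x y → f (x + y) ≈ f x + f y
    linPoly-+ x y = begin
      f (x + y)   ≈⟨ +-cong (+-congˡ (*-congˡ (frob-+ x y))) (*-congˡ (φ-+ 2 x y)) ⟩
      a₀ * (x + y) + a₁ * (pow L x q + pow L y q) + a₂ * (φ 2 x + φ 2 y)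
                  ≈⟨ solve 9 (λ a b c x y u v s t → a :* (x :+ y) :+ b :* (u :+ v) :+ c :* (s :+ t)
                      := (a :* x :+ b :* u :+ c :* s) :+ (a :* y :+ b :* v :+ c :* t)) refl
                      a₀ a₁ a₂ x y (pow L x q) (pow L y q) (φ 2 x) (φ 2 y) ⟩
      f x + f y   ∎

    linPoly-0 : f 0# ≈ 0#
    linPoly-0 = begin
      f 0#                      ≈⟨ +-cong (+-cong (zeroʳ a₀) (*-congˡ (pow-0 0<q))) (*-congˡ (φ-0 2)) ⟩
      0# + a₁ * 0# + a₂ * 0#    ≈⟨ +-cong (trans (+-identityˡ _) (zeroʳ a₁)) (zeroʳ a₂) ⟩
      0# + 0#                   ≈⟨ +-identityˡ 0# ⟩
      0#                        ∎

    linPoly-injective : (∀ x → f x ≈ 0# → x ≈ 0#) → Injective _≈_ _≈_ f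
    linPoly-injective ker {x} {y} fx≈fy = +-cancelʳ (- y) x y (trans (ker (x - y) (begin
      f (x - y)        ≈⟨ linPoly-+ x (- y) ⟩
      f x + f (- y)    ≈⟨ +-congʳ fx≈fy ⟩
      f y + f (- y)    ≈⟨ linPoly-+ y (- y) ⟨
      f (y - y)        ≈⟨ linPoly-cong (-‿inverseʳ y) ⟩
      f 0#             ≈⟨ linPoly-0 ⟩
      0#               ∎)) (sym (-‿inverseʳ y)))

    -- `φ k` respects sums and products, fixes the coefficients and commutes with powers.
    linPoly-φ : ∀ k → InSubfield L q k a₀ → InSubfield L q k a₁ → InSubfield L q k a₂ →
                ∀ x → φ k (f x) ≈ f (φ k x)
    linPoly-φ k Sa₀ Sa₁ Sa₂ x = begin
      φ k (f x)   ≈⟨ trans (φ-+ k _ _) (+-congʳ (φ-+ k _ _)) ⟩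
      φ k (a₀ * x) + φ k (a₁ * pow L x q) + φ k (a₂ * φ 2 x)
                  ≈⟨ +-cong (+-cong (φ-* k _ _) (φ-* k _ _)) (φ-* k _ _) ⟩
      φ k a₀ * φ k x + φ k a₁ * φ k (pow L x q) + φ k a₂ * φ k (φ 2 x)
                  ≈⟨ +-cong (+-cong (*-congʳ Sa₀) (*-cong Sa₁ (φ-pow k x q))) (*-cong Sa₂ (φ-pow k x (q ^ℕ 2))) ⟩
      f (φ k x)   ∎

    -- If y x = x^q and f(x) = 0, then f = (a₂ φ − c) ∘ (φ − y) for φ = (_^q).
    linPoly-factor : ∀ {c y} → a₀ ≈ c * y → c + (a₁ + a₂ * pow L y q) ≈ 0# →
                     ∀ v → f v + c * (pow L v q - y * v) ≈ a₂ * pow L (pow L v q - y * v) q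
    linPoly-factor {c} {y} a₀≈cy c+≈0 v = begin
      -- Expanding (a₂φ - c)(φ - y) gives a₂φ² - (c + a₂y^q)φ + cy, and the two hypotheses match
      -- this with the coefficients of `f`. The term `c * h` is moved to the left.
      f v + c * h
        ≈⟨ +-congʳ (+-cong (+-congʳ (*-congʳ a₀≈cy)) (*-congˡ vq²≈)) ⟩
      c * y * v + a₁ * vq + a₂ * (hq + yq * vq) + c * h
        ≈⟨ solve 9 (λ a b c y v w h s t → c :* y :* v :+ a :* w :+ b :* (s :+ t :* w) :+ c :* h
             := c :* (h :+ y :* v) :+ a :* w :+ b :* s :+ b :* t :* w) refl a₁ a₂ c y v vq h hq yq ⟩
      c * (h + y * v) + a₁ * vq + a₂ * hq + a₂ * yq * vq
        ≈⟨ +-congʳ (+-congʳ (+-congʳ (*-congˡ h+yv≈vq))) ⟩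
      c * vq + a₁ * vq + a₂ * hq + a₂ * yq * vq
        ≈⟨ solve 6 (λ a b c w s t → c :* w :+ a :* w :+ b :* s :+ b :* t :* w
             := (c :+ (a :+ b :* t)) :* w :+ b :* s) refl a₁ a₂ c vq hq yq ⟩
      (c + (a₁ + a₂ * yq)) * vq + a₂ * hq
        ≈⟨ +-congʳ (trans (*-congʳ c+≈0) (zeroˡ vq)) ⟩
      0# + a₂ * hq
        ≈⟨ +-identityˡ _ ⟩
      a₂ * hq ∎
      where
      vq = pow L v q
      yq = pow L y q
      h  = vq - y * v
      hq = pow L h q
      h+yv≈vq : h + y * v ≈ vq
      h+yv≈vq = trans (+-assoc _ _ _) (trans (+-congˡ (-‿inverseˡ _)) (+-identityʳ vq))
      vq²≈ : φ 2 v ≈ hq + yq * vq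
      vq²≈ = begin
        φ 2 v                        ≈⟨ pow-q² v ⟨
        pow L vq q                   ≈⟨ pow-cong q h+yv≈vq ⟨
        pow L (h + y * v) q          ≈⟨ frob-+ h (y * v) ⟩
        hq + pow L (y * v) q         ≈⟨ +-congˡ (pow-* q y v) ⟩
        hq + yq * vq                 ∎

  -- A q-polynomial of q-degree j − 1 satisfying T j ∘ (a φ − c) = N(a) φʲ − N(c).
  module Annihilator (a c : Carrier) where
    T : ℕ → Carrier → Carrier
    T zero    u = 0#
    T (suc j) u = φ j c * T j u + norm L q j a * φ j u

    T-cong : ∀ j {u v} → u ≈ v → T j u ≈ T j v
    T-cong zero    u≈v = refl
    T-cong (suc j) u≈v = +-cong (*-congˡ (T-cong j u≈v)) (*-congˡ (φ-cong j u≈v))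

    -- Here `u` stands for aφ(w) - cw. In the inductive step the two summands of `T` contribute
    -- N(a)φʲ(c)φʲ(w) with opposite signs, and what remains extends both partial norms by one
    -- conjugate.
    T-annihilates : ∀ {u w} → u + c * w ≈ a * pow L w q →
                    ∀ j → T j u + norm L q j c * w ≈ norm L q j a * φ j w
    T-annihilates {u} {w} u+cw≈ zero    = trans (+-identityˡ _) (*-congˡ (sym (*-identityʳ w)))
    T-annihilates {u} {w} u+cw≈ (suc j) = begin
      φ j c * T j u + norm L q j a * φ j u + norm L q (suc j) c * w
        ≈⟨ +-congˡ (*-congʳ (norm-suc j c)) ⟩
      φ j c * T j u + norm L q j a * φ j u + φ j c * norm L q j c * w
        ≈⟨ solve 6 (λ c t a u n w → c :* t :+ a :* u :+ c :* n :* w := c :* (t :+ n :* w) :+ a :* u) refl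
             (φ j c) (T j u) (norm L q j a) (φ j u) (norm L q j c) w ⟩
      φ j c * (T j u + norm L q j c * w) + norm L q j a * φ j u
        ≈⟨ +-congʳ (*-congˡ (T-annihilates u+cw≈ j)) ⟩
      φ j c * (norm L q j a * φ j w) + norm L q j a * φ j u
        ≈⟨ solve 4 (λ c a w u → c :* (a :* w) :+ a :* u := a :* (u :+ c :* w)) refl
             (φ j c) (norm L q j a) (φ j w) (φ j u) ⟩
      norm L q j a * (φ j u + φ j c * φ j w)
        ≈⟨ *-congˡ (trans (+-congˡ (sym (φ-* j c w))) (sym (φ-+ j u (c * w)))) ⟩
      norm L q j a * φ j (u + c * w)
        ≈⟨ *-congˡ (trans (φ-cong j u+cw≈) (trans (φ-* j a _) (*-congˡ (φ-suc j w)))) ⟩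
      norm L q j a * (φ j a * φ (suc j) w)
        ≈⟨ trans (sym (*-assoc _ _ _)) (*-congʳ (trans (*-comm _ _) (sym (norm-suc j a)))) ⟩
      norm L q (suc j) a * φ (suc j) w ∎

    module _ (1<q : 1 < q) (k : ℕ) (1≤k : 1 ≤ℕ k) where
      -- In a field of order q^(2k) the inner map is the trace to F_{q^k}, so vanishing of `T` on
      -- the subfield becomes vanishing of a polynomial on the whole field.
      T∘trace : ℕ → Carrier → Carrier
      T∘trace j v = T j (v + φ k v)

      -- The top coefficient comes from φʲ(φᵏ v) alone: φʲ v has lower degree because k ≥ 1, and the
      -- recursive part is assumed to contribute 0 there.
      T∘trace-poly : ∀ j → Poly (q ^ℕ (k +ℕ j)) 0# (T∘trace j) →
                     Poly (q ^ℕ (k +ℕ j)) (norm L q j a) (T∘trace (suc j))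
      T∘trace-poly j pT = poly-cong D eq (λ v → +-congˡ (*-congˡ (trace-φ v)))
        (poly-+ D (poly-scale D (φ j c) pT) (poly-scale D (norm L q j a) (poly-+ D
          (poly-raise-< (ℕ.^-monoʳ-< q 1<q (ℕ.m<n+m j 1≤k)) (poly-pow (q ^ℕ j))) (poly-pow D))))
        where
        D = q ^ℕ (k +ℕ j)
        eq : φ j c * 0# + norm L q j a * (0# + 1#) ≈ norm L q j a
        eq = trans (+-cong (zeroʳ _) (trans (*-congˡ (+-identityˡ 1#)) (*-identityʳ _))) (+-identityˡ _)
        trace-φ : ∀ v → φ j v + φ (k +ℕ j) v ≈ φ j (v + φ k v)
        trace-φ v = sym (trans (φ-+ j v (φ k v)) (+-congˡ (φ-φ k j v)))

      -- The leading term found for the preceding index has degree below the new bound, so at that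
      -- bound the coefficient is 0.
      T∘trace-low : ∀ j → Poly (q ^ℕ (k +ℕ j)) 0# (T∘trace j)
      T∘trace-low zero    = poly-zero (q ^ℕ (k +ℕ 0))
      T∘trace-low (suc j) = poly-raise-< (ℕ.^-monoʳ-< q 1<q (ℕ.+-monoʳ-< k (ℕ.n<1+n j)))
                              (T∘trace-poly j (T∘trace-low j))

      T∘trace-leading : ∀ j → Poly (q ^ℕ (k +ℕ j)) (norm L q j a) (T∘trace (suc j))
      T∘trace-leading j = T∘trace-poly j (T∘trace-low j)

-- Additivity of the q-th power map.

primePower>1 : ∀ {q} → IsPrimePower q → 1 < q
primePower>1 (p , e , pp , 1≤e , ≡.refl) = ℕ.^-monoʳ-< p (nonTrivial⇒n>1 p ⦃ prime⇒nonTrivial pp ⦄) 1≤e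

-- With q = p^e the order is p^(em), so p times 1 is zero, and the q-th power is the e-fold iterate
-- of the p-th power.
pow-q-additive : ∀ {c ℓ q m} → IsPrimePower q → (L : CommutativeRing c ℓ) → IsFiniteFieldOfOrder L (q ^ℕ m) →
                 Powers.AdditivePow L q
pow-q-additive {m = m} (p , e , pp , _ , ≡.refl) L isFF =
  AdditivePow-^ (frobenius-additive pp (characteristic (e *ℕ m) (ℕ.^-*-assoc p e m))) e
  where
  open Powers L
  open FiniteField L isFF

-- The equivalence for coefficients with opposite norms.

module OppositeNorms {c ℓ} (q k : ℕ) (primePower : IsPrimePower q) (1≤k : k ≥ 1)
            (L : CommutativeRing c ℓ) (isFF : IsFiniteFieldOfOrder L (q ^ℕ (2 *ℕ k)))
            (a₀ a₁ a₂ : CommutativeRing.Carrier L)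
            (Sa₀ : InSubfield L q k a₀) (Sa₁ : InSubfield L q k a₁) (Sa₂ : InSubfield L q k a₂)
            (norms : CommutativeRing._≈_ L (CommutativeRing._+_ L (norm L q k a₀) (norm L q k a₂)) (CommutativeRing.0# L))
            where
  open CommutativeRing L hiding (zero)
  open import Relation.Binary.Reasoning.Setoid setoid
  open import Algebra.Properties.Group +-group
    using (inverseʳ-unique) renaming (∙-cancelˡ to +-cancelˡ; ∙-cancelʳ to +-cancelʳ)
  open import Algebra.Properties.Ring ring using (-‿distribʳ-*; -1*x≈-x)
  open import Algebra.Solver.Ring.NaturalCoefficients.Default commutativeSemiring
  open IsFiniteFieldOfOrder isFF using (0≉1; inverse)
  open Powers L
  open FiniteField L isFF

  1<q : 1 < q
  1<q = primePower>1 primePower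

  frob-+ : AdditivePow q
  frob-+ = pow-q-additive {m = 2 *ℕ k} primePower L isFF

  open Linearized L q (ℕ.<⇒≤ 1<q) frob-+
  open Subfield k

  f : Carrier → Carrier
  f = linPoly L q a₀ a₁ a₂

  f-cong : ∀ {x y} → x ≈ y → f x ≈ f y
  f-cong = linPoly-cong a₀ a₁ a₂

  φk-involutive : ∀ x → φ k (φ k x) ≈ x
  -- The composite is the power map for the order of the field; `2 *ℕ k` unfolds to `k +ℕ (k +ℕ 0)`.
  φk-involutive x = trans (φ-φ k k x) (trans
    (reflexive (≡.cong (λ m → pow L x (q ^ℕ (k +ℕ m))) (≡.sym (ℕ.+-identityʳ k)))) (pow-order x))

  S-trace : ∀ x → S (x + φ k x)
  S-trace x = trans (φ-+ k x (φ k x)) (trans (+-congˡ (φk-involutive x)) (+-comm _ _))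

  bijective⇒permutesSubfield : Bijective _≈_ _≈_ f → PermutesSubset L S f
  bijective⇒permutesSubfield (f-inj , f-surj) = (λ _ _ _ _ → f-inj) , λ y Sy →
    let x , fx = f-surj y in
    x , f-inj (trans (sym (linPoly-φ a₀ a₁ a₂ k Sa₀ Sa₁ Sa₂ x))
          (trans (φ-cong k (fx refl)) (trans Sy (sym (fx refl))))) , fx refl

  -- If T k vanishes on S then v ↦ T k (v + φᵏ v) vanishes on L, but its degree is below |L|.
  T-vanishing⇒a₂≈0 : ∀ c → (∀ u → S u → Annihilator.T a₂ c k u ≈ 0#) → a₂ ≈ 0#
  -- The top coefficient is `a₂` to the power 1 + q + ... + q^(k-2). For k = 1 this is the empty
  -- norm 1, and `pow≈0` then concludes from the contradiction 1 ≈ 0.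
  T-vanishing⇒a₂≈0 c T≈0 = pow≈0 (normExp q (pred k))
    (vanishing-poly (ℕ.^-monoʳ-< q 1<q k+k-1<2k) (A.T∘trace-leading 1<q k 1≤k (pred k))
      λ v → trans (reflexive (≡.cong (λ j → A.T j (v + φ k v)) 1+k-1≡k)) (T≈0 _ (S-trace v)))
    where
    module A = Annihilator a₂ c
    1+k-1≡k : suc (pred k) ≡ k
    1+k-1≡k = ℕ.suc-pred k ⦃ >-nonZero 1≤k ⦄
    k+k-1<2k : k +ℕ pred k < 2 *ℕ k
    k+k-1<2k = ℕ.+-monoʳ-< k (ℕ.≤-reflexive (≡.trans 1+k-1≡k (≡.sym (ℕ.+-identityʳ k))))

  module _ (perm : PermutesSubset L S f) where
    -- As `f` commutes with `φ k`, the trace of a zero is again a zero, and it lies in `S`, where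
    -- `f` is injective.
    φk-kernel : ∀ {x} → f x ≈ 0# → x + φ k x ≈ 0#
    φk-kernel {x} fx≈0 = proj₁ perm _ _ (S-trace x) S-0 (begin
      f (x + φ k x)      ≈⟨ linPoly-+ a₀ a₁ a₂ x (φ k x) ⟩
      f x + f (φ k x)    ≈⟨ +-congˡ (linPoly-φ a₀ a₁ a₂ k Sa₀ Sa₁ Sa₂ x) ⟨
      f x + φ k (f x)    ≈⟨ +-cong fx≈0 (trans (φ-cong k fx≈0) S-0) ⟩
      0# + 0#            ≈⟨ +-identityˡ 0# ⟩
      0#                 ≈⟨ linPoly-0 a₀ a₁ a₂ ⟨
      f 0#               ∎)

    -- Opposite norms force a₀ = 0 as well, so only the middle term of `f` remains. A nonzero zero
    -- would make that vanish too, and then 1 would have no preimage.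
    a₂≈0⇒kernel-trivial : a₂ ≈ 0# → ∀ {x} → ¬ x ≈ 0# → ¬ f x ≈ 0#
    a₂≈0⇒kernel-trivial a₂≈0 {x} x≉0 fx≈0 with v , _ , fv≈1 ← proj₂ perm 1# S-1 =
      0≉1 (trans (sym (trans (f≈ v) (trans (*-congʳ a₁≈0) (zeroˡ _)))) fv≈1)
      where
      a₀≈0 : a₀ ≈ 0#
      a₀≈0 = pow≈0 (normExp q k) (begin
        norm L q k a₀                    ≈⟨ +-identityʳ _ ⟨
        norm L q k a₀ + 0#               ≈⟨ +-congˡ (trans (pow-cong (normExp q k) a₂≈0) (norm-0 k 1≤k)) ⟨
        norm L q k a₀ + norm L q k a₂    ≈⟨ norms ⟩
        0#                               ∎)
      f≈ : ∀ v → f v ≈ a₁ * pow L v q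
      f≈ v = trans (+-cong (+-congʳ (trans (*-congʳ a₀≈0) (zeroˡ _))) (trans (*-congʳ a₂≈0) (zeroˡ _)))
               (trans (+-identityʳ _) (+-identityˡ _))
      a₁≈0 : a₁ ≈ 0#
      a₁≈0 = *-≈0 (trans (sym (f≈ x)) fx≈0) (λ x^q≈0 → x≉0 (pow≈0 q x^q≈0))

    module KernelElement {x} (x≉0 : ¬ x ≈ 0#) (fx≈0 : f x ≈ 0#) where
      y : Carrier
      y = pow L x q * proj₁ (inverse x x≉0)

      yx≈x^q : y * x ≈ pow L x q
      yx≈x^q = trans (*-assoc _ _ _) (trans (*-congˡ (trans (*-comm _ x) (proj₂ (inverse x x≉0)))) (*-identityʳ _))

      φkx≈-x : φ k x ≈ - x
      φkx≈-x = inverseʳ-unique x (φ k x) (φk-kernel fx≈0)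

      φkx≉0 : ¬ φ k x ≈ 0#
      φkx≉0 φkx≈0 = x≉0 (pow≈0 (q ^ℕ k) φkx≈0)

      -- `φ k` turns both `x` and x^q into their negatives, so their quotient is fixed.
      Sy : S y
      Sy = *-cancelʳ-≉0 φkx≉0 (begin
        φ k y * φ k x        ≈⟨ φ-* k y x ⟨
        φ k (y * x)          ≈⟨ φ-cong k yx≈x^q ⟩
        φ k (pow L x q)      ≈⟨ φ-pow k x q ⟩
        pow L (φ k x) q      ≈⟨ pow-cong q φkx≈-x ⟩
        pow L (- x) q        ≈⟨ pow-neg frob-+ (ℕ.<⇒≤ 1<q) x ⟩
        - pow L x q          ≈⟨ -‿cong yx≈x^q ⟨
        - (y * x)            ≈⟨ -‿distribʳ-* y x ⟩
        y * - x              ≈⟨ *-congˡ φkx≈-x ⟨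
        y * φ k x            ∎)

      -- `φ k` multiplies `x` by the norm of its eigenvalue `y`, but also by -1.
      norm-y : norm L q k y ≈ - 1#
      norm-y = *-cancelʳ-≉0 x≉0 (trans (sym (norm-eigenvalue yx≈x^q k)) (trans φkx≈-x (sym (-1*x≈-x x))))

      -- The value of `c₀` is forced by the coefficient of φ in (a₂φ - c₀)(φ - y).
      c₀ yq : Carrier
      yq = pow L y q
      c₀ = - (a₁ + a₂ * yq)

      Sc : S c₀
      Sc = S-neg (S-+ Sa₁ (S-* Sa₂ (S-pow q Sy)))

      c+≈0 : c₀ + (a₁ + a₂ * yq) ≈ 0#
      c+≈0 = -‿inverseˡ _

      -- With this `c₀`, right division of `f` by φ - y leaves the scalar remainder a₀ - c₀y. Both
      -- `f` and φ - y vanish at `x`, so the remainder annihilates the nonzero `x`.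
      a₀≈cy : a₀ ≈ c₀ * y
      a₀≈cy = *-cancelʳ-≉0 x≉0 (+-cancelʳ (a₁ * xq + a₂ * (yq * xq)) _ _ (begin
        a₀ * x + (a₁ * xq + a₂ * (yq * xq))
          ≈⟨ +-assoc _ _ _ ⟨
        a₀ * x + a₁ * xq + a₂ * (yq * xq)
          -- Here x^(q²) = (yx)^q = y^q x^q.
          ≈⟨ +-congˡ (*-congˡ (trans (sym (pow-* q y x)) (trans (pow-cong q yx≈x^q) (pow-q² x)))) ⟩
        f x
          ≈⟨ fx≈0 ⟩
        0#
          ≈⟨ trans (*-congʳ c+≈0) (zeroˡ xq) ⟨
        (c₀ + (a₁ + a₂ * yq)) * xq
          ≈⟨ solve 5 (λ c a b t w → (c :+ (a :+ b :* t)) :* w := c :* w :+ (a :* w :+ b :* (t :* w))) refl c₀ a₁ a₂ yq xq ⟩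
        c₀ * xq + (a₁ * xq + a₂ * (yq * xq))
          ≈⟨ +-congʳ (trans (*-assoc c₀ y x) (*-congˡ yx≈x^q)) ⟨
        c₀ * y * x + (a₁ * xq + a₂ * (yq * xq)) ∎))
        where xq = pow L x q

      -- Since N(y) = -1, the relation a₀ = c₀y gives N(a₀) = -N(c₀), which is compared with
      -- `norms`.
      norm-c≈norm-a₂ : norm L q k c₀ ≈ norm L q k a₂
      norm-c≈norm-a₂ = +-cancelˡ (norm L q k a₀) _ _ (begin
        norm L q k a₀ + norm L q k c₀
          ≈⟨ +-cong (pow-cong (normExp q k) a₀≈cy) (sym (*-identityʳ _)) ⟩
        norm L q k (c₀ * y) + norm L q k c₀ * 1#
          ≈⟨ +-congʳ (trans (pow-* (normExp q k) c₀ y) (*-congˡ norm-y)) ⟩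
        norm L q k c₀ * - 1# + norm L q k c₀ * 1#
          ≈⟨ distribˡ _ _ _ ⟨
        norm L q k c₀ * (- 1# + 1#)
          ≈⟨ trans (*-congˡ (-‿inverseˡ 1#)) (zeroʳ _) ⟩
        0#
          ≈⟨ norms ⟨
        norm L q k a₀ + norm L q k a₂ ∎)

      -- By surjectivity on `S`, u = f(v) = (a₂φ - c₀)(h) with h = φ(v) - yv in `S`. As `φ k` fixes
      -- h, `T k u` is (N(a₂) - N(c₀))h, and the two norms agree.
      T-vanishes : ∀ u → S u → Annihilator.T a₂ c₀ k u ≈ 0#
      T-vanishes u Su with v , Sv , fv≈u ← proj₂ perm u Su = +-cancelʳ (norm L q k c₀ * h) _ _ (begin
        T k u + norm L q k c₀ * h      ≈⟨ +-congʳ (T-cong k fv≈u) ⟨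
        T k (f v) + norm L q k c₀ * h  ≈⟨ T-annihilates (linPoly-factor a₀ a₁ a₂ a₀≈cy c+≈0 v) k ⟩
        norm L q k a₂ * φ k h          ≈⟨ *-cong (sym norm-c≈norm-a₂) Sh ⟩
        norm L q k c₀ * h              ≈⟨ +-identityˡ _ ⟨
        0# + norm L q k c₀ * h         ∎)
        where
        open Annihilator a₂ c₀
        h = pow L v q - y * v
        Sh : S h
        Sh = S-+ (S-pow q Sv) (S-neg (S-* Sy Sv))

    kernel-trivial : ∀ x → f x ≈ 0# → x ≈ 0#
    kernel-trivial x fx≈0 with x ≟ 0#
    ... | yes x≈0 = x≈0
    -- The assumed zero yields `c₀` and hence a₂ = 0, which in turn rules out that zero.
    ... | no  x≉0 = contradiction fx≈0
      (a₂≈0⇒kernel-trivial (T-vanishing⇒a₂≈0 c₀ T-vanishes) x≉0)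
      where open KernelElement x≉0 fx≈0

    permutesSubfield⇒bijective : Bijective _≈_ _≈_ f
    permutesSubfield⇒bijective = f-injective , injective⇒surjective f-cong f-injective
      where
      f-injective : Injective _≈_ _≈_ f
      f-injective = linPoly-injective a₀ a₁ a₂ kernel-trivial

theorem2p4 : {c ℓ : Level} (q k : ℕ) → IsPrimePower q → k ≥ 1 →
    (L : CommutativeRing c ℓ) → IsFiniteFieldOfOrder L (q ^ℕ (2 *ℕ k)) →
    let open CommutativeRing L in
    (a₀ a₁ a₂ : Carrier) →
    InSubfield L q k a₀ → InSubfield L q k a₁ → InSubfield L q k a₂ →
    norm L q k a₀ + norm L q k a₂ ≈ 0# →
    (PermutesSubset L (InSubfield L q k) (linPoly L q a₀ a₁ a₂) →
    Bijective _≈_ _≈_ (linPoly L q a₀ a₁ a₂)) ×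
    (Bijective _≈_ _≈_ (linPoly L q a₀ a₁ a₂) →
    PermutesSubset L (InSubfield L q k) (linPoly L q a₀ a₁ a₂))
theorem2p4 q k primePower 1≤k L isFF a₀ a₁ a₂ Sa₀ Sa₁ Sa₂ norms =
  permutesSubfield⇒bijective , bijective⇒permutesSubfield
  where open OppositeNorms q k primePower 1≤k L isFF a₀ a₁ a₂ Sa₀ Sa₁ Sa₂ norms
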